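{- Let $m$ be a positive integer. In each of the following cases the displayed identity holds, and the triple consisting of $n_1=6m+2$ and the denominators $n_2,n_3$ of the second and third unit fractions on the right-hand side is a wild solution of the Erdős–Straus equation for $24m+1$. (1) If $m=28r-1+c(42r-1)$ with $r\in\mathbb N$, $r>0$, $c\in\mathbb N$, then $$\frac{4}{24m+1}=\frac{1}{6m+2}+\frac{1}{12r(3c+2)(24m+1)}+\frac{1}{12r(3c+2)(42r-1)(24m+1)}.$$ (2) If $m=14r+4+c(42r+13)$ with $r,c\in\mathbb N$, then $$\frac{4}{24m+1}=\frac{1}{6m+2}+\frac{1}{4(3r+1)(3c+1)(24m+1)}+\frac{1}{4(3r+1)(3c+1)(42r+13)(24m+1)}.$$ (3) If $m=7r+3+c(21r+10)$ with $r,c\in\mathbb N$, then $$\frac{4}{24m+1}=\frac{1}{6m+2}+\frac{1}{3(2r+1)(3c+1)(24m+1)}+\frac{1}{6(2r+1)(3c+1)(21r+10)(24m+1)}.$$ (4) If $m=14r+11+c(21r+17)$ with $r,c\in\mathbb N$, then $$\frac{4}{24m+1}=\frac{1}{6m+2}+\frac{1}{(6r+5)(3c+2)(24m+1)}+\frac{1}{2(6r+5)(3c+2)(21r+17)(24m+1)}.$$ (5) If $m=28r+3+c(42r+5)$ with $r\in\mathbb N$, $r>0$, $c\in\mathbb N$, then $$\frac{4}{24m+1}=\frac{1}{6m+2}+\frac{1}{2(6r+1)(3c+2)(24m+1)}+\frac{1}{(6r+1)(3c+2)(42r+5)(24m+1)}.$$ (6) If $m=14r+6+c(42r+19)$ with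 $r,c\in\mathbb N$, then $$\frac{4}{24m+1}=\frac{1}{6m+2}+\frac{1}{6(2r+1)(3c+1)(24m+1)}+\frac{1}{3(2r+1)(3c+1)(42r+19)(24m+1)}.$$
   Context: $\mathbb N$ denotes the set of nonnegative integers. For a positive integer $m$, the Erdős–Straus equation for $n=24m+1$ is $\frac{4}{n}=\frac1{n_1}+\frac1{n_2}+\frac1{n_3}$ in positive integers $n_1,n_2,n_3$. For $n_1=6m+k$ with $1\le k\le 12m$ one has $\frac{4}{24m+1}=\frac{1}{6m+k}+\frac{4k-1}{(6m+k)(24m+1)}$. A solution $(n_1,n_2,n_3)$ is called a wild solution if $n_1=6m+k$ for some integer $1\le k\le 12m$ and there exist an integer $L\ge 2$ (called a multiplier) and positive integers $J_1,J_2$ (called the numerator summands) such that $J_1+J_2=L(4k-1)$, $\gcd(L,J_1,J_2)=1$, $\frac1{n_2}=\frac{J_1}{L(6m+k)(24m+1)}$ and $\frac1{n_3}=\frac{J_2}{L(6m+k)(24m+1)}$. -}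

module Defs where

open import Data.Integer.Base using (+_)
open import Data.Nat.Base
  using (ℕ; _+_; _*_; _∸_; _≤_; _<_; NonZero; >-nonZero; z≤n; s≤s)
open import Data.Nat.GCD using (gcd)
open import Data.Nat.Properties using (m*n≢0; m≤n⇒m≤o+n; ≤-refl; ≤-trans)
open import Data.Rational.Base as ℚ using (_/_)
open import Relation.Binary.PropositionalEquality using (_≡_)

infix 4 4/_≡1/_+1/_+1/_

-- Equality in ℚ.  The positivity of all four denominators is part of the
-- assertion, so no convention for division by zero is involved.
record 4/_≡1/_+1/_+1/_ (n n₁ n₂ n₃ : ℕ) : Set where
  field
    {{n≢0}}  : NonZero n
    {{n₁≢0}} : NonZero n₁
    {{n₂≢0}} : NonZero n₂
    {{n₃≢0}} : NonZero n₃
    equation : + 4 / n ≡ + 1 / n₁ ℚ.+ + 1 / n₂ ℚ.+ + 1 / n₃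

denominator≢0 : ∀ m {k L} → 1 ≤ k → 2 ≤ L →
                NonZero (L * (6 * m + k) * (24 * m + 1))
denominator≢0 m {k} {L} 1≤k 2≤L =
  m*n≢0 (L * (6 * m + k)) (24 * m + 1) {{L*n₁≢0}} {{n≢0}}
  where
  L≢0    = >-nonZero (≤-trans (s≤s z≤n) 2≤L)
  n₁≢0   = >-nonZero (m≤n⇒m≤o+n (6 * m) 1≤k)
  n≢0    = >-nonZero (m≤n⇒m≤o+n (24 * m) ≤-refl)
  L*n₁≢0 = m*n≢0 L (6 * m + k) {{L≢0}} {{n₁≢0}}

-- (n₁ , n₂ , n₃) is a wild solution of the Erdős–Straus equation for 24m + 1,
-- with multiplier L and numerator summands J₁ and J₂.
record WildSolution (m n₁ n₂ n₃ : ℕ) : Set where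
  field
    solution   : 4/ (24 * m + 1) ≡1/ n₁ +1/ n₂ +1/ n₃
    k          : ℕ
    1≤k        : 1 ≤ k
    k≤12m      : k ≤ 12 * m
    n₁≡6m+k    : n₁ ≡ 6 * m + k
    L J₁ J₂    : ℕ
    2≤L        : 2 ≤ L
    0<J₁       : 0 < J₁
    0<J₂       : 0 < J₂
    -- Truncated subtraction is exact here, since 1 ≤ k.
    J₁+J₂      : J₁ + J₂ ≡ L * (4 * k ∸ 1)
    gcd≡1      : gcd L (gcd J₁ J₂) ≡ 1

  open 4/_≡1/_+1/_+1/_ solution

  private instance
    d≢0 : NonZero (L * (6 * m + k) * (24 * m + 1))
    d≢0 = denominator≢0 m 1≤k 2≤L

  field
    1/n₂≡ : + 1 / n₂ ≡ + J₁ / (L * (6 * m + k) * (24 * m + 1))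
    1/n₃≡ : + 1 / n₃ ≡ + J₂ / (L * (6 * m + k) * (24 * m + 1))

{-# OPTIONS --safe #-}
-- Put n₁ = 6m + k and N = 24m + 1.  Since N + (4k − 1) = 4n₁, summands with
-- J₁ + J₂ = L(4k − 1) split 4/N as 1/n₁ + J₁/(L n₁ N) + J₂/(L n₁ N), and the
-- last two terms are the unit fractions 1/(aN) and 1/(bN) as soon as
-- a J₁ = b J₂ = L n₁.  For k = 2 every case of the theorem is a factorisation of
-- 6m + 2 that exhibits such J₁, J₂ and L with J₂ equal to 1 or 2.
module Submission where

open import Data.Integer.Base using (+_)
import Data.Integer.Base as ℤ
import Data.Integer.Properties as ℤ
import Data.Integer.Tactic.RingSolver as ℤ
open import Data.Nat.Base
  using (ℕ; suc; _+_; _*_; _∸_; _≤_; _<_; NonZero; >-nonZero; z≤n; s≤s)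
open import Data.Nat.Coprimality as Coprimality
  using (Coprime; coprime⇒gcd≡1; 1-coprimeTo)
open import Data.Nat.Divisibility using (∣-trans; ∣1⇒≡1; ∣m+n∣m⇒∣n; n∣m*n)
open import Data.Nat.GCD using (gcd; gcd[m,n]∣n)
open import Data.Nat.Properties
open import Data.Nat.Tactic.RingSolver using (solve-∀)
open import Data.Product.Base using (_×_; _,_)
open import Data.Rational.Base as ℚ using (_/_)
open import Data.Rational.Properties
  using (toℚᵘ-injective; toℚᵘ-homo-+; toℚᵘ-fromℚᵘ; fromℚᵘ-cong)
open import Data.Rational.Unnormalised.Base as ℚᵘ using (mkℚᵘ; *≡*)
import Data.Rational.Unnormalised.Properties as ℚᵘ
open import Relation.Binary.PropositionalEquality
  using (_≡_; refl; sym; trans; cong; cong₂; subst; module ≡-Reasoning)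
open import Defs

-- Arithmetic of fractions in ℚ

-- `fromℚᵘ (mkℚᵘ (+ a) b)` unfolds to `+ a / suc b`, so the claim transfers from unnormalised
-- rationals, whose equality is cross-multiplication.
/-cong-* : ∀ a b c d .{{_ : NonZero b}} .{{_ : NonZero d}} →
           a * d ≡ c * b → + a / b ≡ + c / d
/-cong-* a (suc b) c (suc d) ad≡cb =
  fromℚᵘ-cong {mkℚᵘ (+ a) b} {mkℚᵘ (+ c) d} (*≡* (begin
    + a ℤ.* + suc d  ≡⟨ ℤ.pos-* a (suc d) ⟨
    + (a * suc d)    ≡⟨ cong +_ ad≡cb ⟩
    + (c * suc b)    ≡⟨ ℤ.pos-* c (suc b) ⟩
    + c ℤ.* + suc b  ∎))
  where open ≡-Reasoning

-- Addition in ℚ normalises its result. In ℚᵘ the sum is simply `a * d + b * d` over `d * d`, and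
-- cross-multiplying leaves a ring identity.
/-distribʳ-+ : ∀ a b d .{{_ : NonZero d}} →
               + a / d ℚ.+ + b / d ≡ + (a + b) / d
/-distribʳ-+ a b (suc d) = toℚᵘ-injective (begin
  ℚ.toℚᵘ (+ a / suc d ℚ.+ + b / suc d)
    ≈⟨ toℚᵘ-homo-+ (+ a / suc d) (+ b / suc d) ⟩
  ℚ.toℚᵘ (+ a / suc d) ℚᵘ.+ ℚ.toℚᵘ (+ b / suc d)
    ≈⟨ ℚᵘ.+-cong (toℚᵘ-fromℚᵘ (mkℚᵘ (+ a) d)) (toℚᵘ-fromℚᵘ (mkℚᵘ (+ b) d)) ⟩
  mkℚᵘ (+ a) d ℚᵘ.+ mkℚᵘ (+ b) d
    ≈⟨ *≡* (trans (distrib (+ a) (+ b) (+ suc d))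
                  (cong₂ ℤ._*_ (sym (ℤ.pos-+ a b)) (sym (ℤ.pos-* (suc d) (suc d))))) ⟩
  mkℚᵘ (+ (a + b)) d
    ≈⟨ toℚᵘ-fromℚᵘ (mkℚᵘ (+ (a + b)) d) ⟨
  ℚ.toℚᵘ (+ (a + b) / suc d) ∎)
  where
  open ℚᵘ.≃-Reasoning
  distrib : ∀ x y z → (x ℤ.* z ℤ.+ y ℤ.* z) ℤ.* z ≡ (x ℤ.+ y) ℤ.* (z ℤ.* z)
  distrib = ℤ.solve-∀

-- Coprimality of multiplier and summands

coprime⇒gcd[l,gcd[m,n]]≡1 : ∀ {l} m {n} → Coprime l n → gcd l (gcd m n) ≡ 1
coprime⇒gcd[l,gcd[m,n]]≡1 m {n} l⊥n = coprime⇒gcd≡1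
  λ (d∣l , d∣gcd) → l⊥n (d∣l , ∣-trans d∣gcd (gcd[m,n]∣n m n))

-- A common divisor divides `n * m`, hence also 1. Taking `m` to be 2 covers an odd multiplier with
-- `J₂` = 2.
n*m+1-coprimeTo-m : ∀ n m → Coprime (n * m + 1) m
n*m+1-coprimeTo-m n m (d∣nm+1 , d∣m) =
  ∣1⇒≡1 (∣m+n∣m⇒∣n d∣nm+1 (∣-trans d∣m (n∣m*n n)))

-- Wild solutions from factorisations of L n₁

wildSolution : ∀ m k {L J₁ J₂} a b →
  1 ≤ k → k ≤ 12 * m → 2 ≤ L → 0 < J₁ → 0 < J₂ →
  J₁ + J₂ ≡ L * (4 * k ∸ 1) → Coprime L J₂ →
  a * J₁ ≡ L * (6 * m + k) → b * J₂ ≡ L * (6 * m + k) →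
  WildSolution m (6 * m + k) (a * (24 * m + 1)) (b * (24 * m + 1))
wildSolution m k {L} {J₁} {J₂} a b 1≤k k≤12m 2≤L 0<J₁ 0<J₂ J₁+J₂ L⊥J₂ aJ₁ bJ₂ =
  record
  { solution = record { equation = equation }
  ; k        = k
  ; 1≤k      = 1≤k
  ; k≤12m    = k≤12m
  ; n₁≡6m+k  = refl
  ; 2≤L      = 2≤L
  ; 0<J₁     = 0<J₁
  ; 0<J₂     = 0<J₂
  ; J₁+J₂    = J₁+J₂
  ; gcd≡1    = coprime⇒gcd[l,gcd[m,n]]≡1 J₁ L⊥J₂
  ; 1/n₂≡    = unitFraction a aJ₁
  ; 1/n₃≡    = unitFraction b bJ₂
  }
  where
  n₁ = 6 * m + k
  N  = 24 * m + 1
  D  = L * n₁ * N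

  -- Positivity of `a` and `b` is inherited from the product `L * n₁`.
  factor≢0 : ∀ c {J} → c * J ≡ L * n₁ → NonZero c
  factor≢0 c {J} cJ = m*n≢0⇒m≢0 c {{subst NonZero (sym cJ) (m*n≢0 L n₁)}}
    where
    instance
      L≢0 : NonZero L
      L≢0 = >-nonZero (≤-trans (s≤s z≤n) 2≤L)
      n₁≢0′ : NonZero n₁
      n₁≢0′ = >-nonZero (m≤n⇒m≤o+n (6 * m) 1≤k)

  instance
    N≢0 : NonZero N
    N≢0 = >-nonZero (m≤n⇒m≤o+n (24 * m) ≤-refl)
    n₁≢0 : NonZero n₁
    n₁≢0 = >-nonZero (m≤n⇒m≤o+n (6 * m) 1≤k)
    D≢0 : NonZero D
    D≢0 = denominator≢0 m 1≤k 2≤L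
    aN≢0 : NonZero (a * N)
    aN≢0 = m*n≢0 a N {{factor≢0 a aJ₁}}
    bN≢0 : NonZero (b * N)
    bN≢0 = m*n≢0 b N {{factor≢0 b bJ₂}}

  -- The hypothesis is the cross-multiplied conclusion with the common factor `N` cancelled.
  unitFraction : ∀ c {J} .{{_ : NonZero (c * N)}} → c * J ≡ L * n₁ →
                 + 1 / (c * N) ≡ + J / D
  unitFraction c {J} cJ = /-cong-* 1 (c * N) J D (begin
    1 * D        ≡⟨ *-identityˡ D ⟩
    L * n₁ * N   ≡⟨ cong (_* N) cJ ⟨
    c * J * N    ≡⟨ rearrange c J N ⟩
    J * (c * N)  ∎)
    where
    open ≡-Reasoning
    rearrange : ∀ x y z → x * y * z ≡ y * (x * z)
    rearrange = solve-∀

  N+[4k∸1]≡4n₁ : N + (4 * k ∸ 1) ≡ 4 * n₁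
  N+[4k∸1]≡4n₁ = begin
    24 * m + 1 + (4 * k ∸ 1)    ≡⟨ +-assoc (24 * m) 1 (4 * k ∸ 1) ⟩
    24 * m + (1 + (4 * k ∸ 1))
      -- `4 * k` reduces to `k + 3 * k`, so `1 ≤ k` gives `1 ≤ 4 * k` and the truncated subtraction
      -- is exact.
      ≡⟨ cong (λ x → 24 * m + x) (m+[n∸m]≡n (≤-trans 1≤k (m≤m+n k (3 * k)))) ⟩
    24 * m + 4 * k              ≡⟨ rearrange m k ⟩
    4 * (6 * m + k)             ∎
    where
    open ≡-Reasoning
    rearrange : ∀ x y → 24 * x + 4 * y ≡ 4 * (6 * x + y)
    rearrange = solve-∀

  LN+J₁+J₂≡L*4n₁ : L * N + J₁ + J₂ ≡ L * (4 * n₁)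
  LN+J₁+J₂≡L*4n₁ = begin
    L * N + J₁ + J₂            ≡⟨ +-assoc (L * N) J₁ J₂ ⟩
    L * N + (J₁ + J₂)          ≡⟨ cong (λ x → L * N + x) J₁+J₂ ⟩
    L * N + L * (4 * k ∸ 1)    ≡⟨ *-distribˡ-+ L N (4 * k ∸ 1) ⟨
    L * (N + (4 * k ∸ 1))      ≡⟨ cong (λ x → L * x) N+[4k∸1]≡4n₁ ⟩
    L * (4 * n₁)               ∎
    where open ≡-Reasoning

  equation : + 4 / N ≡ + 1 / n₁ ℚ.+ + 1 / (a * N) ℚ.+ + 1 / (b * N)
  equation = begin
    -- Over the common denominator `D` the three terms have numerators `L * N`, `J₁` and `J₂`, whose
    -- sum is `L * (4 * n₁)`.
    + 4 / N                                  ≡⟨ /-cong-* 4 N (L * N + J₁ + J₂) D 4D≡ ⟩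
    + (L * N + J₁ + J₂) / D                  ≡⟨ /-distribʳ-+ (L * N + J₁) J₂ D ⟨
    + (L * N + J₁) / D ℚ.+ + J₂ / D          ≡⟨ cong (ℚ._+ + J₂ / D) (/-distribʳ-+ (L * N) J₁ D) ⟨
    + (L * N) / D ℚ.+ + J₁ / D ℚ.+ + J₂ / D
      ≡⟨ cong₂ ℚ._+_ (cong₂ ℚ._+_ 1/n₁≡ (unitFraction a aJ₁)) (unitFraction b bJ₂) ⟨
    + 1 / n₁ ℚ.+ + 1 / (a * N) ℚ.+ + 1 / (b * N) ∎
    where
    open ≡-Reasoning
    rearrange₁ : ∀ x y z → 4 * (x * y * z) ≡ x * (4 * y) * z
    rearrange₁ = solve-∀
    rearrange₂ : ∀ x y z → 1 * (x * y * z) ≡ x * z * y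
    rearrange₂ = solve-∀
    4D≡ : 4 * D ≡ (L * N + J₁ + J₂) * N
    4D≡ = trans (rearrange₁ L n₁ N) (cong (_* N) (sym LN+J₁+J₂≡L*4n₁))
    1/n₁≡ : + 1 / n₁ ≡ + (L * N) / D
    1/n₁≡ = /-cong-* 1 n₁ (L * N) D (rearrange₂ L n₁ N)

-- The case k = 2, where 4k - 1 = 7

solution×wildSolution : ∀ {m J₁ J₂} L a b → 0 < m →
  2 ≤ L → 0 < J₁ → 0 < J₂ → J₁ + J₂ ≡ L * 7 → Coprime L J₂ →
  a * J₁ ≡ L * (6 * m + 2) → b * J₂ ≡ L * (6 * m + 2) →
  let n₂ = a * (24 * m + 1)
      n₃ = b * (24 * m + 1)
  in (4/ (24 * m + 1) ≡1/ (6 * m + 2) +1/ n₂ +1/ n₃)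
     × WildSolution m (6 * m + 2) n₂ n₃
solution×wildSolution {m} L a b 0<m 2≤L 0<J₁ 0<J₂ J₁+J₂ L⊥J₂ aJ₁ bJ₂ =
  WildSolution.solution w , w
  where
  2≤12m = ≤-trans (s≤s (s≤s z≤n)) (*-monoʳ-≤ 12 0<m)
  w = wildSolution m 2 a b (s≤s z≤n) 2≤12m 2≤L 0<J₁ 0<J₂ J₁+J₂ L⊥J₂ aJ₁ bJ₂

1-coprime : ∀ {L} → Coprime L 1
1-coprime {L} = Coprimality.sym (1-coprimeTo L)

2≤m+[2+n] : ∀ m {n} → 2 ≤ m + (2 + n)
2≤m+[2+n] m = m≤n⇒m≤o+n m (s≤s (s≤s z≤n))

0<m+suc[n] : ∀ m {n} → 0 < m + suc n
0<m+suc[n] m = m≤n⇒m≤o+n m (s≤s z≤n)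

theorem3p2 : (m : ℕ) → 0 < m →
    -- (1); both truncated subtractions are exact because 0 < r
    ((r c : ℕ) → 0 < r → m ≡ 28 * r ∸ 1 + c * (42 * r ∸ 1) →
      let n₂ = 12 * r * (3 * c + 2) * (24 * m + 1)
          n₃ = 12 * r * (3 * c + 2) * (42 * r ∸ 1) * (24 * m + 1)
      in (4/ (24 * m + 1) ≡1/ (6 * m + 2) +1/ n₂ +1/ n₃)
         × WildSolution m (6 * m + 2) n₂ n₃)
  × -- (2)
    ((r c : ℕ) → m ≡ 14 * r + 4 + c * (42 * r + 13) →
      let n₂ = 4 * (3 * r + 1) * (3 * c + 1) * (24 * m + 1)
          n₃ = 4 * (3 * r + 1) * (3 * c + 1) * (42 * r + 13) * (24 * m + 1)
      in (4/ (24 * m + 1) ≡1/ (6 * m + 2) +1/ n₂ +1/ n₃)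
         × WildSolution m (6 * m + 2) n₂ n₃)
  × -- (3)
    ((r c : ℕ) → m ≡ 7 * r + 3 + c * (21 * r + 10) →
      let n₂ = 3 * (2 * r + 1) * (3 * c + 1) * (24 * m + 1)
          n₃ = 6 * (2 * r + 1) * (3 * c + 1) * (21 * r + 10) * (24 * m + 1)
      in (4/ (24 * m + 1) ≡1/ (6 * m + 2) +1/ n₂ +1/ n₃)
         × WildSolution m (6 * m + 2) n₂ n₃)
  × -- (4)
    ((r c : ℕ) → m ≡ 14 * r + 11 + c * (21 * r + 17) →
      let n₂ = (6 * r + 5) * (3 * c + 2) * (24 * m + 1)
          n₃ = 2 * (6 * r + 5) * (3 * c + 2) * (21 * r + 17) * (24 * m + 1)
      in (4/ (24 * m + 1) ≡1/ (6 * m + 2) +1/ n₂ +1/ n₃)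
         × WildSolution m (6 * m + 2) n₂ n₃)
  × -- (5)
    ((r c : ℕ) → 0 < r → m ≡ 28 * r + 3 + c * (42 * r + 5) →
      let n₂ = 2 * (6 * r + 1) * (3 * c + 2) * (24 * m + 1)
          n₃ = (6 * r + 1) * (3 * c + 2) * (42 * r + 5) * (24 * m + 1)
      in (4/ (24 * m + 1) ≡1/ (6 * m + 2) +1/ n₂ +1/ n₃)
         × WildSolution m (6 * m + 2) n₂ n₃)
  × -- (6)
    ((r c : ℕ) → m ≡ 14 * r + 6 + c * (42 * r + 19) →
      let n₂ = 6 * (2 * r + 1) * (3 * c + 1) * (24 * m + 1)
          n₃ = 3 * (2 * r + 1) * (3 * c + 1) * (42 * r + 19) * (24 * m + 1)
      in (4/ (24 * m + 1) ≡1/ (6 * m + 2) +1/ n₂ +1/ n₃)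
         × WildSolution m (6 * m + 2) n₂ n₃)
theorem3p2 m 0<m =
  -- 42 * suc q ∸ 1 and 28 * suc q ∸ 1 reduce to q + 41 * suc q and q + 27 * suc q.
  ( (λ { (suc q) c (s≤s z≤n) refl → solution×wildSolution (suc q * 6)
          (12 * suc q * (3 * c + 2))
          (12 * suc q * (3 * c + 2) * (q + 41 * suc q))
          0<m (s≤s (s≤s z≤n)) (m≤n⇒m≤o+n q (s≤s z≤n)) (s≤s z≤n)
          (sum₁ q) 1-coprime (second₁ q c) (third₁ q c) })
  -- As in the first case, `J₂` = 1 and `J₁` = 7L - 1; the same holds in the next two cases, with L
  -- = 6r + 3 and L = 6r + 5.
  , (λ { r c refl → solution×wildSolution (6 * r + 2)
          (4 * (3 * r + 1) * (3 * c + 1))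
          (4 * (3 * r + 1) * (3 * c + 1) * (42 * r + 13))
          0<m (2≤m+[2+n] (6 * r)) (0<m+suc[n] (42 * r)) (s≤s z≤n)
          (sum₂ r) 1-coprime (second₂ r c) (third₂ r c) })
  , (λ { r c refl → solution×wildSolution (6 * r + 3)
          (3 * (2 * r + 1) * (3 * c + 1))
          (6 * (2 * r + 1) * (3 * c + 1) * (21 * r + 10))
          0<m (2≤m+[2+n] (6 * r)) (0<m+suc[n] (42 * r)) (s≤s z≤n)
          (sum₃ r) 1-coprime (second₃ r c) (third₃ r c) })
  , (λ { r c refl → solution×wildSolution (6 * r + 5)
          ((6 * r + 5) * (3 * c + 2))
          (2 * (6 * r + 5) * (3 * c + 2) * (21 * r + 17))
          0<m (2≤m+[2+n] (6 * r)) (0<m+suc[n] (42 * r)) (s≤s z≤n)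
          (sum₄ r) 1-coprime (second₄ r c) (third₄ r c) })
  -- Now `J₂` = 2 and `J₁` = 7L - 2. The multiplier 6r + 1 is written as a multiple of 2 plus 1 to
  -- show that it is odd; `0 < r` makes it at least 2.
  , (λ { (suc q) c (s≤s z≤n) refl → solution×wildSolution (3 * suc q * 2 + 1)
          (2 * (6 * suc q + 1) * (3 * c + 2))
          ((6 * suc q + 1) * (3 * c + 2) * (42 * suc q + 5))
          0<m (s≤s (s≤s z≤n)) (s≤s z≤n) (s≤s z≤n)
          (sum₅ q) (n*m+1-coprimeTo-m (3 * suc q) 2) (second₅ q c) (third₅ q c) })
  , (λ { r c refl → solution×wildSolution ((3 * r + 1) * 2 + 1)
          (6 * (2 * r + 1) * (3 * c + 1))
          (3 * (2 * r + 1) * (3 * c + 1) * (42 * r + 19))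
          -- `(3 * r + 1) * 2` does not reduce to a successor for variable `r`, so 2 ≤ L is obtained
          -- from 1 ≤ 1 * 2 by monotonicity.
          0<m (+-monoˡ-≤ 1 (≤-trans (s≤s z≤n) (*-monoˡ-≤ 2 (m≤n+m 1 (3 * r)))))
          (0<m+suc[n] (42 * r)) (s≤s z≤n)
          (sum₆ r) (n*m+1-coprimeTo-m (3 * r + 1) 2) (second₆ r c) (third₆ r c) })
  )
  where

  -- Polynomial identities for the six cases

  -- In each case `J₁` divides n₁ = 6m + 2, with quotients 6c + 4, 6c + 2, 3c + 1, 3c + 2, 6c + 4
  -- and 6c + 2 in order. The factor `a` is L times this quotient, and `b` is L n₁ divided by `J₂`.
  sum₁ : ∀ q → q + 41 * suc q + 1 ≡ (suc q * 6) * 7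
  sum₁ = solve-∀
  second₁ : ∀ q c →
    12 * suc q * (3 * c + 2) * (q + 41 * suc q)
    ≡ (suc q * 6) * (6 * (q + 27 * suc q + c * (q + 41 * suc q)) + 2)
  second₁ = solve-∀
  third₁ : ∀ q c →
    12 * suc q * (3 * c + 2) * (q + 41 * suc q) * 1
    ≡ (suc q * 6) * (6 * (q + 27 * suc q + c * (q + 41 * suc q)) + 2)
  third₁ = solve-∀
  sum₂ : ∀ r → 42 * r + 13 + 1 ≡ (6 * r + 2) * 7
  sum₂ = solve-∀
  second₂ : ∀ r c →
    4 * (3 * r + 1) * (3 * c + 1) * (42 * r + 13)
    ≡ (6 * r + 2) * (6 * (14 * r + 4 + c * (42 * r + 13)) + 2)
  second₂ = solve-∀
  third₂ : ∀ r c →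
    4 * (3 * r + 1) * (3 * c + 1) * (42 * r + 13) * 1
    ≡ (6 * r + 2) * (6 * (14 * r + 4 + c * (42 * r + 13)) + 2)
  third₂ = solve-∀
  sum₃ : ∀ r → 42 * r + 20 + 1 ≡ (6 * r + 3) * 7
  sum₃ = solve-∀
  second₃ : ∀ r c →
    3 * (2 * r + 1) * (3 * c + 1) * (42 * r + 20)
    ≡ (6 * r + 3) * (6 * (7 * r + 3 + c * (21 * r + 10)) + 2)
  second₃ = solve-∀
  third₃ : ∀ r c →
    6 * (2 * r + 1) * (3 * c + 1) * (21 * r + 10) * 1
    ≡ (6 * r + 3) * (6 * (7 * r + 3 + c * (21 * r + 10)) + 2)
  third₃ = solve-∀
  sum₄ : ∀ r → 42 * r + 34 + 1 ≡ (6 * r + 5) * 7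
  sum₄ = solve-∀
  second₄ : ∀ r c →
    (6 * r + 5) * (3 * c + 2) * (42 * r + 34)
    ≡ (6 * r + 5) * (6 * (14 * r + 11 + c * (21 * r + 17)) + 2)
  second₄ = solve-∀
  third₄ : ∀ r c →
    2 * (6 * r + 5) * (3 * c + 2) * (21 * r + 17) * 1
    ≡ (6 * r + 5) * (6 * (14 * r + 11 + c * (21 * r + 17)) + 2)
  third₄ = solve-∀
  sum₅ : ∀ q → 42 * suc q + 5 + 2 ≡ (3 * suc q * 2 + 1) * 7
  sum₅ = solve-∀
  second₅ : ∀ q c →
    2 * (6 * suc q + 1) * (3 * c + 2) * (42 * suc q + 5)
    ≡ (3 * suc q * 2 + 1) * (6 * (28 * suc q + 3 + c * (42 * suc q + 5)) + 2)
  second₅ = solve-∀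
  third₅ : ∀ q c →
    (6 * suc q + 1) * (3 * c + 2) * (42 * suc q + 5) * 2
    ≡ (3 * suc q * 2 + 1) * (6 * (28 * suc q + 3 + c * (42 * suc q + 5)) + 2)
  third₅ = solve-∀
  sum₆ : ∀ r → 42 * r + 19 + 2 ≡ ((3 * r + 1) * 2 + 1) * 7
  sum₆ = solve-∀
  second₆ : ∀ r c →
    6 * (2 * r + 1) * (3 * c + 1) * (42 * r + 19)
    ≡ ((3 * r + 1) * 2 + 1) * (6 * (14 * r + 6 + c * (42 * r + 19)) + 2)
  second₆ = solve-∀
  third₆ : ∀ r c →
    3 * (2 * r + 1) * (3 * c + 1) * (42 * r + 19) * 2
    ≡ ((3 * r + 1) * 2 + 1) * (6 * (14 * r + 6 + c * (42 * r + 19)) + 2)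
  third₆ = solve-∀
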